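{- Every formula $\varphi\in Fm$ is equivalent, both through the interderivability relation of $\vdash_H$ and through that of $\models_{\mathcal{LB}}$, to a $\land$-conjunction of clauses with the same variables. That is, for every $\varphi\in Fm$ there is a formula $\psi$ which is a (finite, nonempty) $\land$-conjunction of clauses, in which exactly the variables of $\varphi$ occur, and such that $\varphi\vdash_H\psi$, $\psi\vdash_H\varphi$, $\varphi\models_{\mathcal{LB}}\psi$ and $\psi\models_{\mathcal{LB}}\varphi$.
   Context: $\mathbf{Fm}$ is the algebra of formulas (with universe $Fm$) over a countable set of variables in the language $\{\land,\lor,\otimes,\oplus,\neg\}$ ($\land,\lor,\otimes,\oplus$ binary, $\neg$ unary, no constants). A literal is a variable or a formula $\neg p$ with $p$ a variable. The set of clauses is the least set of formulas containing all literals and closed under $\lor$. $\mathcal{FOUR}$ is the algebra with universe $\{\mathsf f,\bot,\top,\mathsf t\}$ where $\land,\lor$ are meet and join of the lattice order $\leq_t$ with $\mathsf f <_t \bot,\top <_t \mathsf t$ ($\bot,\top$ $\leq_t$-incomparable), $\otimes,\oplus$ are meet and join of the lattice order $\leq_k$ with $\bot <_k \mathsf f,\mathsf t <_k \top$ ($\mathsf f,\mathsf t$ $\leq_k$-incomparable), and $\neg \mathsf f = \mathsf t$, $\neg\mathsf t=\mathsf f$, $\neg\bot=\bot$, $\neg\top=\top$. Let $\mathsf{Tr}=\{\top,\mathsf t\}$. Define $\Gamma\models_{\mathcal{LB}}\varphi$ iff for every homomorphism $h:\mathbf{Fm}\to\mathcal{FOUR}$, $h[\Gamma]\subseteq \mathsf{Tr}$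 implies $h(\varphi)\in\mathsf{Tr}$. $\vdash_H$ is the (finitary, substitution-invariant) consequence relation given by the Hilbert calculus with no axioms and the following rules (premises $/$ conclusion): (R1) $p\land q / p$; (R2) $p\land q/q$; (R3) $p, q/ p\land q$; (R4) $p/p\lor q$; (R5) $p\lor q/q\lor p$; (R6) $p\lor p/p$; (R7) $p\lor(q\lor r)/(p\lor q)\lor r$; (R8) $p\lor(q\land r)/(p\lor q)\land(p\lor r)$; (R9) $(p\lor q)\land(p\lor r)/p\lor(q\land r)$; (R10) $p\lor r/\neg\neg p\lor r$; (R11) $\neg\neg p\lor r/p\lor r$; (R12) $\neg(p\lor q)\lor r/(\neg p\land\neg q)\lor r$; (R13) $(\neg p\land\neg q)\lor r/\neg(p\lor q)\lor r$; (R14) $\neg(p\land q)\lor r/(\neg p\lor\neg q)\lor r$; (R15) $(\neg p\lor\neg q)\lor r/\neg(p\land q)\lor r$; (R16) $(p\otimes q)\lor r/(p\land q)\lor r$; (R17) $(p\land q)\lor r/(p\otimes q)\lor r$; (R18) $(p\oplus q)\lor r/(p\lor q)\lor r$; (R19) $(p\lor q)\lor r/(p\oplus q)\lor r$; (R20) $(\neg p\otimes\neg q)\lor r/\neg(p\otimes q)\lor r$; (R21) $\neg(p\otimes q)\lor r/(\neg p\otimes\neg q)\lor r$; (R22) $(\neg p\oplus\neg q)\lor r/\neg(p\oplus q)\lor r$; (R23) $\neg(p\oplus q)\lor r/(\neg p\oplus\neg q)\lor r$. -}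

module Defs where

open import Data.Nat.Base using (ℕ)
open import Data.Product.Base using (_,_)
open import Function.Base using (_∘_)
open import Level using (0ℓ)
open import Relation.Binary.Core using (Rel)
open import Relation.Binary.Definitions using (Transitive; Antisymmetric)
open import Relation.Binary.Lattice.Definitions using (Supremum; Infimum)
open import Relation.Binary.Lattice.Structures using (IsLattice)
open import Relation.Binary.PropositionalEquality.Core using (_≡_; refl)
open import Relation.Binary.PropositionalEquality.Properties using (isEquivalence)
open import Relation.Unary using (Pred; _∈_; _⊆_; _∪_; ｛_｝)

Var : Set
Var = ℕ

infix  9 ¬_
infixr 8 _⊗_
infixr 7 _∧_
infixr 6 _∨_ _⊕_

data Fm : Set where
  var             : Var → Fm
  _∧_ _∨_ _⊗_ _⊕_ : Fm → Fm → Fm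
  ¬_              : Fm → Fm

vars : Fm → Pred Var 0ℓ
vars (var x) = ｛ x ｝
vars (φ ∧ ψ) = vars φ ∪ vars ψ
vars (φ ∨ ψ) = vars φ ∪ vars ψ
vars (φ ⊗ ψ) = vars φ ∪ vars ψ
vars (φ ⊕ ψ) = vars φ ∪ vars ψ
vars (¬ φ)   = vars φ

data Literal : Pred Fm 0ℓ where
  pos : ∀ x → Literal (var x)
  neg : ∀ x → Literal (¬ var x)

data Clause : Pred Fm 0ℓ where
  literal : ∀ {φ} → Literal φ → Clause φ
  _∨_     : ∀ {φ ψ} → Clause φ → Clause ψ → Clause (φ ∨ ψ)

-- Finite nonempty conjunctions of clauses, bracketed in any way.
data ConjunctionOfClauses : Pred Fm 0ℓ where
  clause : ∀ {φ} → Clause φ → ConjunctionOfClauses φ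
  _∧_    : ∀ {φ ψ} → ConjunctionOfClauses φ → ConjunctionOfClauses ψ →
           ConjunctionOfClauses (φ ∧ ψ)

data Four : Set where
  𝐟 ⊥ ⊤ 𝐭 : Four

infix 4 _≤ₜ_ _≤ₖ_

data _≤ₜ_ : Rel Four 0ℓ where
  𝐟-least    : ∀ {a} → 𝐟 ≤ₜ a
  𝐭-greatest : ∀ {a} → a ≤ₜ 𝐭
  reflexive  : ∀ {a} → a ≤ₜ a

data _≤ₖ_ : Rel Four 0ℓ where
  ⊥-least    : ∀ {a} → ⊥ ≤ₖ a
  ⊤-greatest : ∀ {a} → a ≤ₖ ⊤
  reflexive  : ∀ {a} → a ≤ₖ a

infixr 8 _⊗₄_
infixr 7 _∧₄_
infixr 6 _∨₄_ _⊕₄_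
infix  9 ¬₄_

_∧₄_ _∨₄_ _⊗₄_ _⊕₄_ : Four → Four → Four

𝐟 ∧₄ b = 𝐟
𝐭 ∧₄ b = b
⊥ ∧₄ 𝐟 = 𝐟
⊥ ∧₄ ⊥ = ⊥
⊥ ∧₄ ⊤ = 𝐟
⊥ ∧₄ 𝐭 = ⊥
⊤ ∧₄ 𝐟 = 𝐟
⊤ ∧₄ ⊥ = 𝐟
⊤ ∧₄ ⊤ = ⊤
⊤ ∧₄ 𝐭 = ⊤

𝐟 ∨₄ b = b
𝐭 ∨₄ b = 𝐭
⊥ ∨₄ 𝐟 = ⊥
⊥ ∨₄ ⊥ = ⊥
⊥ ∨₄ ⊤ = 𝐭
⊥ ∨₄ 𝐭 = 𝐭
⊤ ∨₄ 𝐟 = ⊤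
⊤ ∨₄ ⊥ = 𝐭
⊤ ∨₄ ⊤ = ⊤
⊤ ∨₄ 𝐭 = 𝐭

⊥ ⊗₄ b = ⊥
⊤ ⊗₄ b = b
𝐟 ⊗₄ 𝐟 = 𝐟
𝐟 ⊗₄ ⊥ = ⊥
𝐟 ⊗₄ ⊤ = 𝐟
𝐟 ⊗₄ 𝐭 = ⊥
𝐭 ⊗₄ 𝐟 = ⊥
𝐭 ⊗₄ ⊥ = ⊥
𝐭 ⊗₄ ⊤ = 𝐭
𝐭 ⊗₄ 𝐭 = 𝐭

⊥ ⊕₄ b = b
⊤ ⊕₄ b = ⊤
𝐟 ⊕₄ 𝐟 = 𝐟
𝐟 ⊕₄ ⊥ = 𝐟
𝐟 ⊕₄ ⊤ = ⊤
𝐟 ⊕₄ 𝐭 = ⊤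
𝐭 ⊕₄ 𝐟 = ⊤
𝐭 ⊕₄ ⊥ = 𝐭
𝐭 ⊕₄ ⊤ = ⊤
𝐭 ⊕₄ 𝐭 = 𝐭

¬₄_ : Four → Four
¬₄ 𝐟 = 𝐭
¬₄ ⊥ = ⊥
¬₄ ⊤ = ⊤
¬₄ 𝐭 = 𝐟

private
  ≤ₜ-trans : Transitive _≤ₜ_
  ≤ₜ-trans 𝐟-least    _          = 𝐟-least
  ≤ₜ-trans reflexive  q          = q
  ≤ₜ-trans 𝐭-greatest 𝐭-greatest = 𝐭-greatest
  ≤ₜ-trans 𝐭-greatest reflexive  = 𝐭-greatest

  ≤ₜ-antisym : Antisymmetric _≡_ _≤ₜ_
  ≤ₜ-antisym 𝐟-least    𝐟-least    = refl
  ≤ₜ-antisym 𝐟-least    reflexive  = refl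
  ≤ₜ-antisym 𝐭-greatest 𝐭-greatest = refl
  ≤ₜ-antisym 𝐭-greatest reflexive  = refl
  ≤ₜ-antisym reflexive  _          = refl

  ≤ₖ-trans : Transitive _≤ₖ_
  ≤ₖ-trans ⊥-least    _          = ⊥-least
  ≤ₖ-trans reflexive  q          = q
  ≤ₖ-trans ⊤-greatest ⊤-greatest = ⊤-greatest
  ≤ₖ-trans ⊤-greatest reflexive  = ⊤-greatest

  ≤ₖ-antisym : Antisymmetric _≡_ _≤ₖ_
  ≤ₖ-antisym ⊥-least    ⊥-least    = refl
  ≤ₖ-antisym ⊥-least    reflexive  = refl
  ≤ₖ-antisym ⊤-greatest ⊤-greatest = refl
  ≤ₖ-antisym ⊤-greatest reflexive  = refl
  ≤ₖ-antisym reflexive  _          = refl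

  ∧-infimum : Infimum _≤ₜ_ _∧₄_
  ∧-infimum 𝐟 b = 𝐟-least , 𝐟-least , λ _ p _ → p
  ∧-infimum 𝐭 b = 𝐭-greatest , reflexive , λ _ _ q → q
  ∧-infimum ⊥ 𝐟 = 𝐟-least , reflexive , λ _ _ q → q
  ∧-infimum ⊥ ⊥ = reflexive , reflexive , λ _ p _ → p
  ∧-infimum ⊥ ⊤ = 𝐟-least , 𝐟-least ,
    λ { 𝐟 _ _ → 𝐟-least ; ⊥ _ () ; ⊤ () _ ; 𝐭 () _ }
  ∧-infimum ⊥ 𝐭 = reflexive , 𝐭-greatest , λ _ p _ → p
  ∧-infimum ⊤ 𝐟 = 𝐟-least , reflexive , λ _ _ q → q
  ∧-infimum ⊤ ⊥ = 𝐟-least , 𝐟-least ,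
    λ { 𝐟 _ _ → 𝐟-least ; ⊥ () _ ; ⊤ _ () ; 𝐭 () _ }
  ∧-infimum ⊤ ⊤ = reflexive , reflexive , λ _ p _ → p
  ∧-infimum ⊤ 𝐭 = reflexive , 𝐭-greatest , λ _ p _ → p

  ∨-supremum : Supremum _≤ₜ_ _∨₄_
  ∨-supremum 𝐟 b = 𝐟-least , reflexive , λ _ _ q → q
  ∨-supremum 𝐭 b = reflexive , 𝐭-greatest , λ _ p _ → p
  ∨-supremum ⊥ 𝐟 = reflexive , 𝐟-least , λ _ p _ → p
  ∨-supremum ⊥ ⊥ = reflexive , reflexive , λ _ p _ → p
  ∨-supremum ⊥ ⊤ = 𝐭-greatest , 𝐭-greatest ,
    λ { 𝐟 () _ ; ⊥ _ () ; ⊤ () _ ; 𝐭 _ _ → 𝐭-greatest }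
  ∨-supremum ⊥ 𝐭 = 𝐭-greatest , reflexive , λ _ _ q → q
  ∨-supremum ⊤ 𝐟 = reflexive , 𝐟-least , λ _ p _ → p
  ∨-supremum ⊤ ⊥ = 𝐭-greatest , 𝐭-greatest ,
    λ { 𝐟 () _ ; ⊥ () _ ; ⊤ _ () ; 𝐭 _ _ → 𝐭-greatest }
  ∨-supremum ⊤ ⊤ = reflexive , reflexive , λ _ p _ → p
  ∨-supremum ⊤ 𝐭 = 𝐭-greatest , reflexive , λ _ _ q → q

  ⊗-infimum : Infimum _≤ₖ_ _⊗₄_
  ⊗-infimum ⊥ b = ⊥-least , ⊥-least , λ _ p _ → p
  ⊗-infimum ⊤ b = ⊤-greatest , reflexive , λ _ _ q → q
  ⊗-infimum 𝐟 𝐟 = reflexive , reflexive , λ _ p _ → p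
  ⊗-infimum 𝐟 ⊥ = ⊥-least , reflexive , λ _ _ q → q
  ⊗-infimum 𝐟 ⊤ = reflexive , ⊤-greatest , λ _ p _ → p
  ⊗-infimum 𝐟 𝐭 = ⊥-least , ⊥-least ,
    λ { 𝐟 _ () ; ⊥ _ _ → ⊥-least ; ⊤ () _ ; 𝐭 () _ }
  ⊗-infimum 𝐭 𝐟 = ⊥-least , ⊥-least ,
    λ { 𝐟 () _ ; ⊥ _ _ → ⊥-least ; ⊤ () _ ; 𝐭 _ () }
  ⊗-infimum 𝐭 ⊥ = ⊥-least , reflexive , λ _ _ q → q
  ⊗-infimum 𝐭 ⊤ = reflexive , ⊤-greatest , λ _ p _ → p
  ⊗-infimum 𝐭 𝐭 = reflexive , reflexive , λ _ p _ → p

  ⊕-supremum : Supremum _≤ₖ_ _⊕₄_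
  ⊕-supremum ⊥ b = ⊥-least , reflexive , λ _ _ q → q
  ⊕-supremum ⊤ b = reflexive , ⊤-greatest , λ _ p _ → p
  ⊕-supremum 𝐟 𝐟 = reflexive , reflexive , λ _ p _ → p
  ⊕-supremum 𝐟 ⊥ = reflexive , ⊥-least , λ _ p _ → p
  ⊕-supremum 𝐟 ⊤ = ⊤-greatest , reflexive , λ _ _ q → q
  ⊕-supremum 𝐟 𝐭 = ⊤-greatest , ⊤-greatest ,
    λ { 𝐟 _ () ; ⊥ () _ ; ⊤ _ _ → ⊤-greatest ; 𝐭 () _ }
  ⊕-supremum 𝐭 𝐟 = ⊤-greatest , ⊤-greatest ,
    λ { 𝐟 () _ ; ⊥ () _ ; ⊤ _ _ → ⊤-greatest ; 𝐭 _ () }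
  ⊕-supremum 𝐭 ⊥ = reflexive , ⊥-least , λ _ p _ → p
  ⊕-supremum 𝐭 ⊤ = ⊤-greatest , reflexive , λ _ _ q → q
  ⊕-supremum 𝐭 𝐭 = reflexive , reflexive , λ _ p _ → p

≤ₜ-isLattice : IsLattice _≡_ _≤ₜ_ _∨₄_ _∧₄_
≤ₜ-isLattice = record
  { isPartialOrder = record
    { isPreorder = record
      { isEquivalence = isEquivalence
      ; reflexive     = λ { refl → reflexive }
      ; trans         = ≤ₜ-trans
      }
    ; antisym = ≤ₜ-antisym
    }
  ; supremum = ∨-supremum
  ; infimum  = ∧-infimum
  }

≤ₖ-isLattice : IsLattice _≡_ _≤ₖ_ _⊕₄_ _⊗₄_
≤ₖ-isLattice = record
  { isPartialOrder = record
    { isPreorder = record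
      { isEquivalence = isEquivalence
      ; reflexive     = λ { refl → reflexive }
      ; trans         = ≤ₖ-trans
      }
    ; antisym = ≤ₖ-antisym
    }
  ; supremum = ⊕-supremum
  ; infimum  = ⊗-infimum
  }

Tr : Pred Four 0ℓ
Tr = ｛ ⊤ ｝ ∪ ｛ 𝐭 ｝

record IsHomomorphism (h : Fm → Four) : Set where
  field
    ∧-homo : ∀ φ ψ → h (φ ∧ ψ) ≡ h φ ∧₄ h ψ
    ∨-homo : ∀ φ ψ → h (φ ∨ ψ) ≡ h φ ∨₄ h ψ
    ⊗-homo : ∀ φ ψ → h (φ ⊗ ψ) ≡ h φ ⊗₄ h ψ
    ⊕-homo : ∀ φ ψ → h (φ ⊕ ψ) ≡ h φ ⊕₄ h ψ
    ¬-homo : ∀ φ → h (¬ φ) ≡ ¬₄ h φ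

infix 3 _⊨LB_ _⊢H_

_⊨LB_ : Pred Fm 0ℓ → Fm → Set
Γ ⊨LB φ = ∀ (h : Fm → Four) → IsHomomorphism h → Γ ⊆ Tr ∘ h → h φ ∈ Tr

-- p, q, r range over all formulas, so each constructor below comprises every
-- substitution instance of the corresponding rule.
data _⊢H_ (Γ : Pred Fm 0ℓ) : Fm → Set where
  premise : ∀ {φ} → φ ∈ Γ → Γ ⊢H φ
  R1  : ∀ {p q} → Γ ⊢H p ∧ q → Γ ⊢H p
  R2  : ∀ {p q} → Γ ⊢H p ∧ q → Γ ⊢H q
  R3  : ∀ {p q} → Γ ⊢H p → Γ ⊢H q → Γ ⊢H p ∧ q
  R4  : ∀ {p q} → Γ ⊢H p → Γ ⊢H p ∨ q
  R5  : ∀ {p q} → Γ ⊢H p ∨ q → Γ ⊢H q ∨ p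
  R6  : ∀ {p} → Γ ⊢H p ∨ p → Γ ⊢H p
  R7  : ∀ {p q r} → Γ ⊢H p ∨ (q ∨ r) → Γ ⊢H (p ∨ q) ∨ r
  R8  : ∀ {p q r} → Γ ⊢H p ∨ (q ∧ r) → Γ ⊢H (p ∨ q) ∧ (p ∨ r)
  R9  : ∀ {p q r} → Γ ⊢H (p ∨ q) ∧ (p ∨ r) → Γ ⊢H p ∨ (q ∧ r)
  R10 : ∀ {p r} → Γ ⊢H p ∨ r → Γ ⊢H ¬ ¬ p ∨ r
  R11 : ∀ {p r} → Γ ⊢H ¬ ¬ p ∨ r → Γ ⊢H p ∨ r
  R12 : ∀ {p q r} → Γ ⊢H ¬ (p ∨ q) ∨ r → Γ ⊢H (¬ p ∧ ¬ q) ∨ r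
  R13 : ∀ {p q r} → Γ ⊢H (¬ p ∧ ¬ q) ∨ r → Γ ⊢H ¬ (p ∨ q) ∨ r
  R14 : ∀ {p q r} → Γ ⊢H ¬ (p ∧ q) ∨ r → Γ ⊢H (¬ p ∨ ¬ q) ∨ r
  R15 : ∀ {p q r} → Γ ⊢H (¬ p ∨ ¬ q) ∨ r → Γ ⊢H ¬ (p ∧ q) ∨ r
  R16 : ∀ {p q r} → Γ ⊢H (p ⊗ q) ∨ r → Γ ⊢H (p ∧ q) ∨ r
  R17 : ∀ {p q r} → Γ ⊢H (p ∧ q) ∨ r → Γ ⊢H (p ⊗ q) ∨ r
  R18 : ∀ {p q r} → Γ ⊢H (p ⊕ q) ∨ r → Γ ⊢H (p ∨ q) ∨ r
  R19 : ∀ {p q r} → Γ ⊢H (p ∨ q) ∨ r → Γ ⊢H (p ⊕ q) ∨ r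
  R20 : ∀ {p q r} → Γ ⊢H (¬ p ⊗ ¬ q) ∨ r → Γ ⊢H ¬ (p ⊗ q) ∨ r
  R21 : ∀ {p q r} → Γ ⊢H ¬ (p ⊗ q) ∨ r → Γ ⊢H (¬ p ⊗ ¬ q) ∨ r
  R22 : ∀ {p q r} → Γ ⊢H (¬ p ⊕ ¬ q) ∨ r → Γ ⊢H ¬ (p ⊕ q) ∨ r
  R23 : ∀ {p q r} → Γ ⊢H ¬ (p ⊕ q) ∨ r → Γ ⊢H (¬ p ⊕ ¬ q) ∨ r

{-# OPTIONS --safe #-}
-- Call φ below ψ when φ ∨ r derives ψ ∨ r for every side formula r.  The
-- rules R7–R23 say that this preorder validates the De Morgan laws, the
-- distributive law and the coincidence of ⊗ with ∧ and of ⊕ with ∨, and R4, R6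
-- turn it into derivability.  So negations can be pushed down to the variables
-- and disjunctions distributed over conjunctions as in classical logic, and no
-- variable is lost on the way.  The semantic half is soundness of the calculus.
module Submission where

open import Defs
open import Data.Bool.Base using (Bool; true; false)
import Data.Bool.Properties as Bool
open import Data.Product.Base using (∃-syntax; _×_; _,_; proj₁; proj₂)
open import Data.Product.Properties using (≡-dec)
open import Data.Sum.Base using (_⊎_; inj₁; inj₂; [_,_]; map₁)
import Data.Sum.Base as Sum
open import Function.Base using (_∘_; id)
open import Level using (0ℓ)
open import Relation.Binary.Definitions using (DecidableEquality)
open import Relation.Binary.PropositionalEquality
  using (_≡_; refl; sym; trans; cong; cong₂; subst)
open import Relation.Nullary.Decidable
  using (Dec; map′; from-yes; _×-dec_; _⊎-dec_; _→-dec_)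
open import Relation.Unary using (Pred; Decidable; ｛_｝; _∈_; _≐_)
open import Relation.Unary.Properties using (≐-refl; ≐-sym; ≐-trans)

-- Derived rules of the calculus

module _ {Γ : Pred Fm 0ℓ} where

  -- Two uses of `R7` separated by `R5` rotate the disjuncts through `(r ∨ p) ∨ q` and
  -- `(q ∨ r) ∨ p`; a last `R5` brings `p` to the front.
  assocʳ : ∀ {p q r} → Γ ⊢H (p ∨ q) ∨ r → Γ ⊢H p ∨ (q ∨ r)
  assocʳ = R5 ∘ R7 ∘ R5 ∘ R7 ∘ R5

  weakenˡ : ∀ {p q r} → Γ ⊢H q ∨ r → Γ ⊢H (p ∨ q) ∨ r
  weakenˡ = R7 ∘ R5 ∘ R4

  weakenʳ : ∀ {p q r} → Γ ⊢H p ∨ r → Γ ⊢H (p ∨ q) ∨ r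
  weakenʳ = R5 ∘ assocʳ ∘ R4 ∘ R5

  -- R5 and R7 only permute the disjuncts cyclically; the transposition comes
  -- from weakening to two copies of the target and contracting them by R6.
  comm : ∀ {p q r} → Γ ⊢H (q ∨ p) ∨ r → Γ ⊢H (p ∨ q) ∨ r
  comm = R6 ∘ R7 ∘ weakenʳ ∘ assocʳ ∘ R5 ∘ weakenʳ ∘ weakenˡ ∘ assocʳ

  -- `R9` wants the side formula on the left, so `R5` moves it there and back.
  ∧-introᶜ : ∀ {p q r} → Γ ⊢H p ∨ r → Γ ⊢H q ∨ r → Γ ⊢H (p ∧ q) ∨ r
  ∧-introᶜ d e = R5 (R9 (R3 (R5 d) (R5 e)))

  ∧-elimᶜ₁ : ∀ {p q r} → Γ ⊢H (p ∧ q) ∨ r → Γ ⊢H p ∨ r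
  ∧-elimᶜ₁ = R5 ∘ R1 ∘ R8 ∘ R5

  ∧-elimᶜ₂ : ∀ {p q r} → Γ ⊢H (p ∧ q) ∨ r → Γ ⊢H q ∨ r
  ∧-elimᶜ₂ = R5 ∘ R2 ∘ R8 ∘ R5

-- Equivalence under arbitrary side formulas.

infix 3 _⊴_ _≋_

record _⊴_ (φ ψ : Fm) : Set₁ where
  constructor rule
  field apply : ∀ {Γ r} → Γ ⊢H φ ∨ r → Γ ⊢H ψ ∨ r

open _⊴_

-- Take `ψ` itself as the side formula: `R4` supplies it, and `R6` contracts the resulting `ψ ∨ ψ`.
⊴⇒⊢ : ∀ {φ ψ} → φ ⊴ ψ → ｛ φ ｝ ⊢H ψ
⊴⇒⊢ f = R6 (apply f (R4 (premise refl)))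

record _≋_ (φ ψ : Fm) : Set₁ where
  constructor equiv
  field
    sameVars : vars φ ≐ vars ψ
    to       : φ ⊴ ψ
    from     : ψ ⊴ φ

open _≋_

≋-refl : ∀ {φ} → φ ≋ φ
≋-refl = equiv ≐-refl (rule id) (rule id)

≋-sym : ∀ {φ ψ} → φ ≋ ψ → ψ ≋ φ
≋-sym (equiv v f g) = equiv (≐-sym v) g f

≋-trans : ∀ {φ ψ χ} → φ ≋ ψ → ψ ≋ χ → φ ≋ χ
≋-trans (equiv v f g) (equiv w h k) =
  equiv (≐-trans v w) (rule (apply h ∘ apply f)) (rule (apply g ∘ apply k))

∧-cong : ∀ {p p′ q q′} → p ≋ p′ → q ≋ q′ → p ∧ q ≋ p′ ∧ q′
∧-cong (equiv (v , v′) f g) (equiv (w , w′) h k) =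
  equiv (Sum.map v w , Sum.map v′ w′) (mono f h) (mono g k)
  where
  mono : ∀ {p p′ q q′} → p ⊴ p′ → q ⊴ q′ → p ∧ q ⊴ p′ ∧ q′
  mono f h = rule λ d → ∧-introᶜ (apply f (∧-elimᶜ₁ d)) (apply h (∧-elimᶜ₂ d))

∨-comm : ∀ p q → p ∨ q ≋ q ∨ p
∨-comm p q = equiv (Sum.swap , Sum.swap) (rule comm) (rule comm)

-- Reassociation absorbs `q` into the side formula, which is why `_⊴_` quantifies over all of them.
∨-congʳ : ∀ {p p′ q} → p ≋ p′ → p ∨ q ≋ p′ ∨ q
∨-congʳ (equiv (v , v′) f g) =
  equiv (map₁ v , map₁ v′) (rule (R7 ∘ apply f ∘ assocʳ)) (rule (R7 ∘ apply g ∘ assocʳ))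

∨-cong : ∀ {p p′ q q′} → p ≋ p′ → q ≋ q′ → p ∨ q ≋ p′ ∨ q′
∨-cong {p} {p′} {q} {q′} e f =
  ≋-trans (∨-congʳ e) (≋-trans (∨-comm p′ q) (≋-trans (∨-congʳ f) (∨-comm q′ p′)))

∨-distribʳ-∧ : ∀ p q r → (p ∧ q) ∨ r ≋ (p ∨ r) ∧ (q ∨ r)
∨-distribʳ-∧ p q r = equiv
  ( [ [ inj₁ ∘ inj₁ , inj₂ ∘ inj₁ ] , inj₁ ∘ inj₂ ]
  , [ [ inj₁ ∘ inj₁ , inj₂ ] , [ inj₁ ∘ inj₂ , inj₂ ] ] )
  (rule λ d → ∧-introᶜ (R7 (∧-elimᶜ₁ (assocʳ d))) (R7 (∧-elimᶜ₂ (assocʳ d))))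
  (rule λ d → R7 (∧-introᶜ (assocʳ (∧-elimᶜ₁ d)) (assocʳ (∧-elimᶜ₂ d))))

∨-distribˡ-∧ : ∀ p q r → p ∨ (q ∧ r) ≋ (p ∨ q) ∧ (p ∨ r)
∨-distribˡ-∧ p q r =
  ≋-trans (∨-comm p (q ∧ r))
    (≋-trans (∨-distribʳ-∧ q r p) (∧-cong (∨-comm q p) (∨-comm r p)))

¬¬-elim : ∀ p → ¬ ¬ p ≋ p
¬¬-elim p = equiv ≐-refl (rule R11) (rule R10)

¬-∨ : ∀ p q → ¬ (p ∨ q) ≋ ¬ p ∧ ¬ q
¬-∨ p q = equiv ≐-refl (rule R12) (rule R13)

¬-∧ : ∀ p q → ¬ (p ∧ q) ≋ ¬ p ∨ ¬ q
¬-∧ p q = equiv ≐-refl (rule R14) (rule R15)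

⊗≋∧ : ∀ p q → p ⊗ q ≋ p ∧ q
⊗≋∧ p q = equiv ≐-refl (rule R16) (rule R17)

⊕≋∨ : ∀ p q → p ⊕ q ≋ p ∨ q
⊕≋∨ p q = equiv ≐-refl (rule R18) (rule R19)

¬-⊗ : ∀ p q → ¬ (p ⊗ q) ≋ ¬ p ⊗ ¬ q
¬-⊗ p q = equiv ≐-refl (rule R21) (rule R20)

¬-⊕ : ∀ p q → ¬ (p ⊕ q) ≋ ¬ p ⊕ ¬ q
¬-⊕ p q = equiv ≐-refl (rule R23) (rule R22)

-- Conjunctive normal forms

HasCNF : Fm → Set₁
HasCNF φ = ∃[ ψ ] (ConjunctionOfClauses ψ × φ ≋ ψ)

hasCNF-resp : ∀ {φ χ} → φ ≋ χ → HasCNF χ → HasCNF φ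
hasCNF-resp e (ψ , c , f) = ψ , c , ≋-trans e f

literal-hasCNF : ∀ {φ} → Literal φ → HasCNF φ
literal-hasCNF l = _ , clause (literal l) , ≋-refl

∧-hasCNF : ∀ {φ ψ} → HasCNF φ → HasCNF ψ → HasCNF (φ ∧ ψ)
∧-hasCNF (_ , c , e) (_ , d , f) = _ , c ∧ d , ∧-cong e f

-- The left conjunction is distributed first, then the right one; this ends in disjunctions of two
-- clauses, which are clauses.
conjunctions-∨-hasCNF : ∀ {φ ψ} →
  ConjunctionOfClauses φ → ConjunctionOfClauses ψ → HasCNF (φ ∨ ψ)
conjunctions-∨-hasCNF (c ∧ c′) d =
  hasCNF-resp (∨-distribʳ-∧ _ _ _)
    (∧-hasCNF (conjunctions-∨-hasCNF c d) (conjunctions-∨-hasCNF c′ d))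
conjunctions-∨-hasCNF (clause c) (d ∧ d′) =
  hasCNF-resp (∨-distribˡ-∧ _ _ _)
    (∧-hasCNF (conjunctions-∨-hasCNF (clause c) d) (conjunctions-∨-hasCNF (clause c) d′))
conjunctions-∨-hasCNF (clause c) (clause d) = _ , clause (c ∨ d) , ≋-refl

∨-hasCNF : ∀ {φ ψ} → HasCNF φ → HasCNF ψ → HasCNF (φ ∨ ψ)
∨-hasCNF (_ , c , e) (_ , d , f) = hasCNF-resp (∨-cong e f) (conjunctions-∨-hasCNF c d)

⊗-hasCNF : ∀ {φ ψ} → HasCNF φ → HasCNF ψ → HasCNF (φ ⊗ ψ)
⊗-hasCNF c d = hasCNF-resp (⊗≋∧ _ _) (∧-hasCNF c d)

⊕-hasCNF : ∀ {φ ψ} → HasCNF φ → HasCNF ψ → HasCNF (φ ⊕ ψ)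
⊕-hasCNF c d = hasCNF-resp (⊕≋∨ _ _) (∨-hasCNF c d)

mutual
  hasCNF : ∀ φ → HasCNF φ
  hasCNF (var x) = literal-hasCNF (pos x)
  hasCNF (φ ∧ ψ) = ∧-hasCNF (hasCNF φ) (hasCNF ψ)
  hasCNF (φ ∨ ψ) = ∨-hasCNF (hasCNF φ) (hasCNF ψ)
  hasCNF (φ ⊗ ψ) = ⊗-hasCNF (hasCNF φ) (hasCNF ψ)
  hasCNF (φ ⊕ ψ) = ⊕-hasCNF (hasCNF φ) (hasCNF ψ)
  hasCNF (¬ φ)   = ¬-hasCNF φ

  -- The De Morgan laws lead to `¬ φ` and `¬ ψ`, which are not subformulas of `¬ (φ ∧ ψ)`. Recursion
  -- on the formula under the negation keeps the induction structural.
  ¬-hasCNF : ∀ φ → HasCNF (¬ φ)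
  ¬-hasCNF (var x) = literal-hasCNF (neg x)
  ¬-hasCNF (φ ∧ ψ) = hasCNF-resp (¬-∧ φ ψ) (∨-hasCNF (¬-hasCNF φ) (¬-hasCNF ψ))
  ¬-hasCNF (φ ∨ ψ) = hasCNF-resp (¬-∨ φ ψ) (∧-hasCNF (¬-hasCNF φ) (¬-hasCNF ψ))
  ¬-hasCNF (φ ⊗ ψ) = hasCNF-resp (¬-⊗ φ ψ) (⊗-hasCNF (¬-hasCNF φ) (¬-hasCNF ψ))
  ¬-hasCNF (φ ⊕ ψ) = hasCNF-resp (¬-⊕ φ ψ) (⊕-hasCNF (¬-hasCNF φ) (¬-hasCNF ψ))
  ¬-hasCNF (¬ φ)   = hasCNF-resp (¬¬-elim φ) (hasCNF φ)

-- Soundness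

-- The bits record evidence for truth and evidence for falsity; the first is set exactly on `Tr`.
-- Decidable equality is inherited from `Bool` this way.
encode : Four → Bool × Bool
encode 𝐟 = false , true
encode ⊥ = false , false
encode ⊤ = true , true
encode 𝐭 = true , false

decode : Bool × Bool → Four
decode (false , true)  = 𝐟
decode (false , false) = ⊥
decode (true  , true)  = ⊤
decode (true  , false) = 𝐭

decode-encode : ∀ a → decode (encode a) ≡ a
decode-encode 𝐟 = refl
decode-encode ⊥ = refl
decode-encode ⊤ = refl
decode-encode 𝐭 = refl

infix 4 _≟_

_≟_ : DecidableEquality Four
a ≟ b = map′
  (λ e → trans (sym (decode-encode a)) (trans (cong decode e) (decode-encode b)))
  (cong encode)
  (≡-dec Bool._≟_ Bool._≟_ (encode a) (encode b))

Tr? : Decidable Tr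
Tr? a = (⊤ ≟ a) ⊎-dec (𝐭 ≟ a)

-- With only four values, universally quantified laws can be decided by evaluating truth tables.
all? : ∀ {P : Pred Four 0ℓ} → Decidable P → Dec (∀ a → P a)
all? P? = map′
  (λ { (x , _) 𝐟 → x ; (_ , x , _) ⊥ → x ; (_ , _ , x , _) ⊤ → x ; (_ , _ , _ , x) 𝐭 → x })
  (λ f → f 𝐟 , f ⊥ , f ⊤ , f 𝐭)
  (P? 𝐟 ×-dec P? ⊥ ×-dec P? ⊤ ×-dec P? 𝐭)

-- Negation laws and primality of `Tr`, by truth tables.

¬₄-involutive : ∀ a → ¬₄ ¬₄ a ≡ a
¬₄-involutive = from-yes (all? λ a → ¬₄ ¬₄ a ≟ a)

¬₄-∨₄ : ∀ a b → ¬₄ (a ∨₄ b) ≡ ¬₄ a ∧₄ ¬₄ b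
¬₄-∨₄ = from-yes (all? λ a → all? λ b → ¬₄ (a ∨₄ b) ≟ ¬₄ a ∧₄ ¬₄ b)

¬₄-∧₄ : ∀ a b → ¬₄ (a ∧₄ b) ≡ ¬₄ a ∨₄ ¬₄ b
¬₄-∧₄ = from-yes (all? λ a → all? λ b → ¬₄ (a ∧₄ b) ≟ ¬₄ a ∨₄ ¬₄ b)

-- `¬₄_` reverses `_≤ₜ_` but preserves `_≤ₖ_`, so it commutes with `_⊗₄_` and `_⊕₄_` instead of
-- exchanging them.
¬₄-⊗₄ : ∀ a b → ¬₄ (a ⊗₄ b) ≡ ¬₄ a ⊗₄ ¬₄ b
¬₄-⊗₄ = from-yes (all? λ a → all? λ b → ¬₄ (a ⊗₄ b) ≟ ¬₄ a ⊗₄ ¬₄ b)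

¬₄-⊕₄ : ∀ a b → ¬₄ (a ⊕₄ b) ≡ ¬₄ a ⊕₄ ¬₄ b
¬₄-⊕₄ = from-yes (all? λ a → all? λ b → ¬₄ (a ⊕₄ b) ≟ ¬₄ a ⊕₄ ¬₄ b)

-- The four instances below express that `Tr` is a prime bifilter, that is, a prime filter for both
-- lattice orders.
Conjunctive Disjunctive : (Four → Four → Four) → Set
Conjunctive _•_ = ∀ a b → ((a • b) ∈ Tr → a ∈ Tr × b ∈ Tr) × (a ∈ Tr × b ∈ Tr → (a • b) ∈ Tr)
Disjunctive _•_ = ∀ a b → ((a • b) ∈ Tr → a ∈ Tr ⊎ b ∈ Tr) × (a ∈ Tr ⊎ b ∈ Tr → (a • b) ∈ Tr)

conjunctive? : ∀ _•_ → Dec (Conjunctive _•_)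
conjunctive? _•_ = all? λ a → all? λ b →
  (Tr? (a • b) →-dec (Tr? a ×-dec Tr? b)) ×-dec ((Tr? a ×-dec Tr? b) →-dec Tr? (a • b))

disjunctive? : ∀ _•_ → Dec (Disjunctive _•_)
disjunctive? _•_ = all? λ a → all? λ b →
  (Tr? (a • b) →-dec (Tr? a ⊎-dec Tr? b)) ×-dec ((Tr? a ⊎-dec Tr? b) →-dec Tr? (a • b))

∧₄-conjunctive : Conjunctive _∧₄_
∧₄-conjunctive = from-yes (conjunctive? _∧₄_)

⊗₄-conjunctive : Conjunctive _⊗₄_
⊗₄-conjunctive = from-yes (conjunctive? _⊗₄_)

∨₄-disjunctive : Disjunctive _∨₄_
∨₄-disjunctive = from-yes (disjunctive? _∨₄_)

⊕₄-disjunctive : Disjunctive _⊕₄_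
⊕₄-disjunctive = from-yes (disjunctive? _⊕₄_)

-- Designated formulas under a fixed homomorphism.

module _ {h : Fm → Four} (hom : IsHomomorphism h) where
  open IsHomomorphism hom

  infix 4 ⊩_

  ⊩_ : Pred Fm 0ℓ
  ⊩ φ = h φ ∈ Tr

  ∧⁻ : ∀ {p q} → ⊩ p ∧ q → ⊩ p × ⊩ q
  ∧⁻ = proj₁ (∧₄-conjunctive _ _) ∘ subst Tr (∧-homo _ _)

  ∧⁺ : ∀ {p q} → ⊩ p × ⊩ q → ⊩ p ∧ q
  ∧⁺ = subst Tr (sym (∧-homo _ _)) ∘ proj₂ (∧₄-conjunctive _ _)

  ⊗⁻ : ∀ {p q} → ⊩ p ⊗ q → ⊩ p × ⊩ q
  ⊗⁻ = proj₁ (⊗₄-conjunctive _ _) ∘ subst Tr (⊗-homo _ _)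

  ⊗⁺ : ∀ {p q} → ⊩ p × ⊩ q → ⊩ p ⊗ q
  ⊗⁺ = subst Tr (sym (⊗-homo _ _)) ∘ proj₂ (⊗₄-conjunctive _ _)

  ∨⁻ : ∀ {p q} → ⊩ p ∨ q → ⊩ p ⊎ ⊩ q
  ∨⁻ = proj₁ (∨₄-disjunctive _ _) ∘ subst Tr (∨-homo _ _)

  ∨⁺ : ∀ {p q} → ⊩ p ⊎ ⊩ q → ⊩ p ∨ q
  ∨⁺ = subst Tr (sym (∨-homo _ _)) ∘ proj₂ (∨₄-disjunctive _ _)

  ⊕⁻ : ∀ {p q} → ⊩ p ⊕ q → ⊩ p ⊎ ⊩ q
  ⊕⁻ = proj₁ (⊕₄-disjunctive _ _) ∘ subst Tr (⊕-homo _ _)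

  ⊕⁺ : ∀ {p q} → ⊩ p ⊎ ⊩ q → ⊩ p ⊕ q
  ⊕⁺ = subst Tr (sym (⊕-homo _ _)) ∘ proj₂ (⊕₄-disjunctive _ _)

  ∨-mapˡ : ∀ {p q r} → (⊩ p → ⊩ q) → ⊩ p ∨ r → ⊩ q ∨ r
  ∨-mapˡ f = ∨⁺ ∘ map₁ f ∘ ∨⁻

  ≡-∨ : ∀ {p q r} → h p ≡ h q → ⊩ p ∨ r → ⊩ q ∨ r
  ≡-∨ e = ∨-mapˡ (subst Tr e)

  ¬¬-homo : ∀ p → h (¬ ¬ p) ≡ h p
  ¬¬-homo p = trans (¬-homo (¬ p)) (trans (cong ¬₄_ (¬-homo p)) (¬₄-involutive (h p)))

  deMorgan : ∀ {_•_ _⋆_ : Fm → Fm → Fm} (_•₄_ _⋆₄_ : Four → Four → Four) →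
    (∀ φ ψ → h (φ • ψ) ≡ h φ •₄ h ψ) → (∀ φ ψ → h (φ ⋆ ψ) ≡ h φ ⋆₄ h ψ) →
    (∀ a b → ¬₄ (a •₄ b) ≡ (¬₄ a) ⋆₄ (¬₄ b)) →
    ∀ p q → h (¬ (p • q)) ≡ h ((¬ p) ⋆ (¬ q))
  deMorgan _ _⋆₄_ •-homo ⋆-homo dm p q =
    trans (¬-homo _) (trans (cong ¬₄_ (•-homo p q)) (trans (dm (h p) (h q))
      (sym (trans (⋆-homo _ _) (cong₂ _⋆₄_ (¬-homo p) (¬-homo q))))))

  ¬∨-homo : ∀ p q → h (¬ (p ∨ q)) ≡ h (¬ p ∧ ¬ q)
  ¬∨-homo = deMorgan _∨₄_ _∧₄_ ∨-homo ∧-homo ¬₄-∨₄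

  ¬∧-homo : ∀ p q → h (¬ (p ∧ q)) ≡ h (¬ p ∨ ¬ q)
  ¬∧-homo = deMorgan _∧₄_ _∨₄_ ∧-homo ∨-homo ¬₄-∧₄

  ¬⊗-homo : ∀ p q → h (¬ (p ⊗ q)) ≡ h (¬ p ⊗ ¬ q)
  ¬⊗-homo = deMorgan _⊗₄_ _⊗₄_ ⊗-homo ⊗-homo ¬₄-⊗₄

  ¬⊕-homo : ∀ p q → h (¬ (p ⊕ q)) ≡ h (¬ p ⊕ ¬ q)
  ¬⊕-homo = deMorgan _⊕₄_ _⊕₄_ ⊕-homo ⊕-homo ¬₄-⊕₄

  ⊢H-preserves-⊩ : ∀ {Γ φ} → (∀ {χ} → χ ∈ Γ → ⊩ χ) → Γ ⊢H φ → ⊩ φ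
  ⊢H-preserves-⊩ {Γ} ⊩Γ = go
    where
    go : ∀ {φ} → Γ ⊢H φ → ⊩ φ
    go (premise x) = ⊩Γ x
    go (R1 d)   = proj₁ (∧⁻ (go d))
    go (R2 d)   = proj₂ (∧⁻ (go d))
    go (R3 d e) = ∧⁺ (go d , go e)
    go (R4 d)   = ∨⁺ (inj₁ (go d))
    go (R5 d)   = ∨⁺ (Sum.swap (∨⁻ (go d)))
    go (R6 d)   = Sum.reduce (∨⁻ (go d))
    go (R7 d)   = ∨⁺ (map₁ ∨⁺ (Sum.assocˡ (Sum.map₂ ∨⁻ (∨⁻ (go d)))))
    go (R8 d)   = ∧⁺ ([ (λ x → ∨⁺ (inj₁ x) , ∨⁺ (inj₁ x))
                      , (λ y → let u , v = ∧⁻ y in ∨⁺ (inj₂ u) , ∨⁺ (inj₂ v)) ] (∨⁻ (go d)))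
    go (R9 d)   = let u , v = ∧⁻ (go d) in
                  ∨⁺ ([ inj₁ , (λ y → Sum.map₂ (λ z → ∧⁺ (y , z)) (∨⁻ v)) ] (∨⁻ u))
    -- In the negation rules the exchanged left disjuncts have equal values under `h`.
    go (R10 {p} d)     = ≡-∨ (sym (¬¬-homo p)) (go d)
    go (R11 {p} d)     = ≡-∨ (¬¬-homo p) (go d)
    go (R12 {p} {q} d) = ≡-∨ (¬∨-homo p q) (go d)
    go (R13 {p} {q} d) = ≡-∨ (sym (¬∨-homo p q)) (go d)
    go (R14 {p} {q} d) = ≡-∨ (¬∧-homo p q) (go d)
    go (R15 {p} {q} d) = ≡-∨ (sym (¬∧-homo p q)) (go d)
    -- Here values may differ, as in `𝐟 ⊗₄ ⊥ = ⊥` and `𝐟 ∧₄ ⊥ = 𝐟`; only membership in `Tr` agrees.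
    go (R16 d) = ∨-mapˡ (∧⁺ ∘ ⊗⁻) (go d)
    go (R17 d) = ∨-mapˡ (⊗⁺ ∘ ∧⁻) (go d)
    go (R18 d) = ∨-mapˡ (∨⁺ ∘ ⊕⁻) (go d)
    go (R19 d) = ∨-mapˡ (⊕⁺ ∘ ∨⁻) (go d)
    go (R20 {p} {q} d) = ≡-∨ (sym (¬⊗-homo p q)) (go d)
    go (R21 {p} {q} d) = ≡-∨ (¬⊗-homo p q) (go d)
    go (R22 {p} {q} d) = ≡-∨ (sym (¬⊕-homo p q)) (go d)
    go (R23 {p} {q} d) = ≡-∨ (¬⊕-homo p q) (go d)

soundness : ∀ {Γ φ} → Γ ⊢H φ → Γ ⊨LB φ
soundness d h hom ⊩Γ = ⊢H-preserves-⊩ hom ⊩Γ d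

theorem3p2p9 : ∀ (φ : Fm) →
    ∃[ ψ ] (ConjunctionOfClauses ψ
    × (vars φ ≐ vars ψ)
    × (｛ φ ｝ ⊢H ψ)
    × (｛ ψ ｝ ⊢H φ)
    × (｛ φ ｝ ⊨LB ψ)
    × (｛ ψ ｝ ⊨LB φ))
theorem3p2p9 φ =
  let ψ , c , e = hasCNF φ
      φ⊢ψ = ⊴⇒⊢ (to e)
      ψ⊢φ = ⊴⇒⊢ (from e)
  in ψ , c , sameVars e , φ⊢ψ , ψ⊢φ , soundness φ⊢ψ , soundness ψ⊢φ
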